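{- Let $\mathcal{D}\subseteq\mathbb{R}^m$ be a polyhedron and $c,d\in\mathbb{R}^m$, and consider the problem $\inf\ c^\top x/d^\top x$ subject to $d^\top x>0$, $x\in\mathcal{D}$. If $\mathcal{D}\cap\{x: d^\top x>0\}\ne\emptyset$, then the optimal value of this problem is $-\infty$ if and only if at least one of the following holds: (1) there exists $x\in\mathcal{D}$ with $c^\top x<0$ and $d^\top x=0$; (2) there exists $r\in\mathbb{R}^m$ with $c^\top r<0$, $d^\top r=0$, and $x+\lambda r\in\mathcal{D}$ for all $x\in\mathcal{D}$ and all $\lambda\ge0$. -}

module Defs where

open import Algebra.Bundles using (CommutativeRing)
open import Algebra.Core using (Op₁)
import Algebra.Properties.CommutativeMonoid.Sum as Sum
open import Data.Fin.Base using (Fin)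
open import Data.Nat.Base using (ℕ)
open import Data.Product.Base using (Σ-syntax; ∃-syntax; _×_)
open import Data.Vec.Functional using (Vector)
open import Function.Bundles using (_⇔_)
open import Level using (0ℓ) renaming (suc to lsuc)
import Relation.Binary.Construct.Add.Extrema.NonStrict as AddExtrema
import Relation.Binary.Construct.StrictToNonStrict as ToNonStrict
open import Relation.Binary.Core using (Rel)
open import Relation.Binary.Structures using (IsStrictTotalOrder)
open import Relation.Nullary.Construct.Add.Extrema using (_±; [_])
open import Relation.Unary using (Pred; Satisfiable)

-- The real numbers, given axiomatically as a Dedekind-complete ordered field
-- (unique up to isomorphism).  The order is the classical one: trichotomy is
-- part of IsStrictTotalOrder.
record RealNumbers : Set (lsuc 0ℓ) where
  field
    commutativeRing : CommutativeRing 0ℓ 0ℓ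

  open CommutativeRing commutativeRing public

  infix 4 _<_
  infix 8 _⁻¹

  field
    _<_                : Rel Carrier 0ℓ
    isStrictTotalOrder : IsStrictTotalOrder _≈_ _<_
    0<1                : 0# < 1#
    +-monoˡ-<          : ∀ z {x y} → x < y → x + z < y + z
    *-pos              : ∀ {x y} → 0# < x → 0# < y → 0# < x * y
    -- The value of 0# ⁻¹ is unspecified.
    _⁻¹                : Op₁ Carrier
    ⁻¹-inverseʳ        : ∀ {x} → x ≉ 0# → x * x ⁻¹ ≈ 1#

  open ToNonStrict _≈_ _<_ public using (_≤_)

  UpperBound : Pred Carrier 0ℓ → Pred Carrier 0ℓ
  UpperBound P b = ∀ {x} → P x → x ≤ b

  field
    complete : (P : Pred Carrier 0ℓ) → Satisfiable P → Satisfiable (UpperBound P) →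
               ∃[ s ] UpperBound P s × (∀ {b} → UpperBound P b → s ≤ b)

  infixl 7 _/_
  _/_ : Carrier → Carrier → Carrier
  x / y = x * y ⁻¹

module FractionalProgramming (ℝ : RealNumbers) where
  open RealNumbers ℝ public
  open Sum +-commutativeMonoid using (sum)
  open AddExtrema _≤_ public using (_≤±_)

  ℝ^_ : ℕ → Set
  ℝ^ m = Vector Carrier m

  infixl 7 _·_ _*ᵥ_
  infixl 6 _+ᵥ_

  _·_ : ∀ {m} → ℝ^ m → ℝ^ m → Carrier
  x · y = sum (λ i → x i * y i)

  _+ᵥ_ : ∀ {m} → ℝ^ m → ℝ^ m → ℝ^ m
  (x +ᵥ y) i = x i + y i

  _*ᵥ_ : ∀ {m} → Carrier → ℝ^ m → ℝ^ m
  (t *ᵥ x) i = t * x i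

  IsPolyhedron : ∀ {m} → Pred (ℝ^ m) 0ℓ → Set
  IsPolyhedron {m} 𝒟 =
    ∃[ k ] Σ[ A ∈ (Fin k → ℝ^ m) ] Σ[ b ∈ ℝ^ k ]
      (∀ x → 𝒟 x ⇔ (∀ i → A i · x ≤ b i))

  -- Infimum in the extended reals Carrier ± of the values of f on the set F.
  IsInfimum : {X : Set} → Pred X 0ℓ → (X → Carrier) → Pred (Carrier ±) 0ℓ
  IsInfimum F f v =
    (∀ {x} → F x → v ≤± [ f x ]) ×
    (∀ {w} → (∀ {x} → F x → w ≤± [ f x ]) → w ≤± v)

  Feasible : ∀ {m} → Pred (ℝ^ m) 0ℓ → ℝ^ m → Pred (ℝ^ m) 0ℓ
  Feasible 𝒟 d x = 0# < d · x × 𝒟 x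

  -- v is the optimal value of  inf c·x / d·x  subject to  d·x > 0, x ∈ 𝒟.
  IsOptimalValue : ∀ {m} → Pred (ℝ^ m) 0ℓ → (c d : ℝ^ m) → Pred (Carrier ±) 0ℓ
  IsOptimalValue 𝒟 c d = IsInfimum (Feasible 𝒟 d) (λ x → (c · x) / (d · x))

{-# OPTIONS --safe #-}
module Submission where

-- Projecting { (x, v, q, s) : A x ≤ s b, c·x ≤ v, d·x = q } along x by Fourier–Motzkin elimination
-- leaves finitely many inequalities α v + β q + γ s ≥ 0, all with α ≥ 0.  If (-1, 0, 0) satisfies
-- them, it lifts to a ray as in (2); if some (-u, 0, 1) with u > 0 does, it lifts to a point as in (1).
-- Otherwise some row has α > 0, and some row has γ < 0 or γ = 0 < α; a positive combination of the two
-- has α > 0 ≥ γ, which at s = 1 reads c·x / d·x ≥ - β / α.  Conversely, if M were a lower bound then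
-- c - M d would be nonnegative on the feasible points, which fails near a point as in (1) and far along
-- a ray as in (2).  Trichotomy makes every case distinction decidable.

open import Defs
import Algebra.Properties.Ring as RingProperties
import Algebra.Solver.Ring.NaturalCoefficients.Default as SemiringSolver
open import Data.Empty using (⊥; ⊥-elim)
open import Data.Fin.Base using (Fin; zero; suc; splitAt)
open import Data.List.Base as List using (List; []; _∷_)
open import Data.List.Relation.Unary.All as All using (All; []; _∷_)
import Data.List.Relation.Unary.All.Properties as All
open import Data.List.Relation.Unary.Any using (Any; here; there)
open import Data.List.Membership.Propositional using (find)
open import Data.Nat.Base as ℕ using (ℕ)
open import Data.Product.Base using (∃-syntax; _×_; _,_; proj₁; proj₂)
open import Data.Sum.Base as Sum using (_⊎_; inj₁; inj₂; [_,_]′)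
open import Data.Vec.Functional using (_++_; tail) renaming ([] to []ᵥ; _∷_ to _∷ᵥ_)
open import Function.Base using (_∘_)
open import Function.Bundles using (_⇔_; mk⇔; Equivalence)
import Function.Construct.Composition as ⇔
open import Level using (0ℓ)
open import Relation.Binary.Bundles using (StrictTotalOrder)
import Relation.Binary.Construct.Add.Extrema.NonStrict as Extrema
import Relation.Binary.Construct.Add.Supremum.NonStrict as Supremum
open import Relation.Binary.Definitions using (tri<; tri≈; tri>)
import Relation.Binary.Properties.StrictTotalOrder as StrictTotalOrderProperties
open import Relation.Binary.PropositionalEquality.Core as ≡ using (_≡_)
open import Relation.Nullary.Construct.Add.Extrema using (⊥±; [_]; ⊤±)
open import Relation.Nullary.Negation using (¬_)
open import Relation.Unary using (Pred)

-- Ordered field arithmetic and interpolation between finitely many bounds.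

module OrderedField (ℝ : RealNumbers) where
  open FractionalProgramming ℝ

  strictTotalOrder : StrictTotalOrder 0ℓ 0ℓ 0ℓ
  strictTotalOrder = record { isStrictTotalOrder = isStrictTotalOrder }

  open StrictTotalOrder strictTotalOrder public
    using (compare; irrefl; asym; <-respˡ-≈; <-respʳ-≈) renaming (trans to <-trans)
  open StrictTotalOrderProperties strictTotalOrder public
    using (≤-respˡ-≈; ≤-respʳ-≈) renaming (antisym to ≤-antisym; trans to ≤-trans)
  open RingProperties ring public
    using (-‿distribˡ-*; -‿distribʳ-*; -‿involutive; -1*x≈-x)
  open SemiringSolver commutativeSemiring public
    using (solve; _:+_; _:*_; _:=_; con)

  <⇒≤ : ∀ {x y} → x < y → x ≤ y
  <⇒≤ = inj₁

  ≤-refl : ∀ {x} → x ≤ x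
  ≤-refl = inj₂ refl

  <⇒≱ : ∀ {x y} → x < y → ¬ (y ≤ x)
  <⇒≱ x<y (inj₁ y<x) = asym x<y y<x
  <⇒≱ x<y (inj₂ y≈x) = irrefl (sym y≈x) x<y

  ≤∨> : ∀ x y → x ≤ y ⊎ y < x
  ≤∨> x y with compare x y
  ... | tri< x<y _ _ = inj₁ (inj₁ x<y)
  ... | tri≈ _ x≈y _ = inj₁ (inj₂ x≈y)
  ... | tri> _ _ y<x = inj₂ y<x

  +-monoˡ-≤ : ∀ z {x y} → x ≤ y → x + z ≤ y + z
  +-monoˡ-≤ z = Sum.map (+-monoˡ-< z) +-congʳ

  x+z-z≈x : ∀ x z → x + z - z ≈ x
  x+z-z≈x x z = trans (+-assoc x z (- z)) (trans (+-congˡ (-‿inverseʳ z)) (+-identityʳ x))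

  x-z+z≈x : ∀ x z → x - z + z ≈ x
  x-z+z≈x x z = trans (+-assoc x (- z) z) (trans (+-congˡ (-‿inverseˡ z)) (+-identityʳ x))

  x≤y⇒0≤y-x : ∀ {x y} → x ≤ y → 0# ≤ y - x
  x≤y⇒0≤y-x {x} x≤y = ≤-respˡ-≈ (-‿inverseʳ x) (+-monoˡ-≤ (- x) x≤y)

  0≤y-x⇒x≤y : ∀ {x y} → 0# ≤ y - x → x ≤ y
  0≤y-x⇒x≤y {x} {y} p = ≤-respʳ-≈ (x-z+z≈x y x) (≤-respˡ-≈ (+-identityˡ x) (+-monoˡ-≤ x p))

  x<y⇒0<y-x : ∀ {x y} → x < y → 0# < y - x
  x<y⇒0<y-x {x} x<y = <-respˡ-≈ (-‿inverseʳ x) (+-monoˡ-< (- x) x<y)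

  x<0⇒0<-x : ∀ {x} → x < 0# → 0# < - x
  x<0⇒0<-x {x} x<0 = <-respʳ-≈ (+-identityˡ (- x)) (x<y⇒0<y-x x<0)

  0≤-x⇒x≤0 : ∀ {x} → 0# ≤ - x → x ≤ 0#
  0≤-x⇒x≤0 {x} p = 0≤y-x⇒x≤y (≤-respʳ-≈ (sym (+-identityˡ (- x))) p)

  x≤0⇒0≤-x : ∀ {x} → x ≤ 0# → 0# ≤ - x
  x≤0⇒0≤-x {x} p = ≤-respʳ-≈ (+-identityˡ (- x)) (x≤y⇒0≤y-x p)

  0<x⇒-x<0 : ∀ {x} → 0# < x → - x < 0#
  0<x⇒-x<0 {x} p = <-respʳ-≈ (-‿inverseʳ x) (<-respˡ-≈ (+-identityˡ (- x)) (+-monoˡ-< (- x) p))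

  ≤-<-trans : ∀ {x y z} → x ≤ y → y < z → x < z
  ≤-<-trans (inj₁ x<y) y<z = <-trans x<y y<z
  ≤-<-trans (inj₂ x≈y) y<z = <-respˡ-≈ (sym x≈y) y<z

  +-nonNeg : ∀ {x y} → 0# ≤ x → 0# ≤ y → 0# ≤ x + y
  +-nonNeg {x} {y} 0≤x 0≤y = ≤-trans 0≤y (≤-respˡ-≈ (+-identityˡ y) (+-monoˡ-≤ y 0≤x))

  +-pos-nonNeg : ∀ {x y} → 0# < x → 0# ≤ y → 0# < x + y
  +-pos-nonNeg {x} {y} 0<x 0≤y = ≤-<-trans 0≤y (<-respˡ-≈ (+-identityˡ y) (+-monoˡ-< y 0<x))

  +-mono-≤ : ∀ {x y u v} → x ≤ y → u ≤ v → x + u ≤ y + v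
  +-mono-≤ {x} {y} {u} {v} x≤y u≤v = ≤-trans (+-monoˡ-≤ u x≤y)
    (≤-respˡ-≈ (+-comm u y) (≤-respʳ-≈ (+-comm v y) (+-monoˡ-≤ y u≤v)))

  *-nonNeg : ∀ {x y} → 0# ≤ x → 0# ≤ y → 0# ≤ x * y
  *-nonNeg {x} {y} (inj₂ 0≈x) _ = inj₂ (trans (sym (zeroˡ y)) (*-congʳ 0≈x))
  *-nonNeg {x} {y} (inj₁ _) (inj₂ 0≈y) = inj₂ (trans (sym (zeroʳ x)) (*-congˡ 0≈y))
  *-nonNeg (inj₁ 0<x) (inj₁ 0<y) = inj₁ (*-pos 0<x 0<y)

  *-monoˡ-≤ : ∀ {t x y} → 0# ≤ t → x ≤ y → t * x ≤ t * y
  *-monoˡ-≤ {t} {x} {y} 0≤t x≤y = 0≤y-x⇒x≤y (≤-respʳ-≈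
    (trans (distribˡ t y (- x)) (+-congˡ (sym (-‿distribʳ-* t x))))
    (*-nonNeg 0≤t (x≤y⇒0≤y-x x≤y)))

  *-monoʳ-≤ : ∀ {t x y} → 0# ≤ t → x ≤ y → x * t ≤ y * t
  *-monoʳ-≤ {t} {x} {y} 0≤t x≤y =
    ≤-respˡ-≈ (*-comm t x) (≤-respʳ-≈ (*-comm t y) (*-monoˡ-≤ 0≤t x≤y))

  pos-inverse : ∀ {x} → 0# < x → x * x ⁻¹ ≈ 1#
  pos-inverse 0<x = ⁻¹-inverseʳ (λ x≈0 → irrefl (sym x≈0) 0<x)

  ⁻¹-pos : ∀ {x} → 0# < x → 0# < x ⁻¹
  ⁻¹-pos {x} 0<x with ≤∨> (x ⁻¹) 0#
  ... | inj₂ 0<x⁻¹ = 0<x⁻¹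
  ... | inj₁ x⁻¹≤0 = ⊥-elim (<⇒≱ 0<1 (0≤-x⇒x≤0
    (≤-respʳ-≈ (trans (sym (-‿distribʳ-* x (x ⁻¹))) (-‿cong (pos-inverse 0<x)))
      (*-nonNeg (<⇒≤ 0<x) (x≤0⇒0≤-x x⁻¹≤0)))))

  x⁻¹*[x*y]≈y : ∀ {x} y → 0# < x → x ⁻¹ * (x * y) ≈ y
  x⁻¹*[x*y]≈y {x} y 0<x = trans (sym (*-assoc (x ⁻¹) x y))
    (trans (*-congʳ (trans (*-comm (x ⁻¹) x) (pos-inverse 0<x))) (*-identityˡ y))

  x*[x⁻¹*y]≈y : ∀ {x} y → 0# < x → x * (x ⁻¹ * y) ≈ y
  x*[x⁻¹*y]≈y {x} y 0<x = trans (sym (*-assoc x (x ⁻¹) y))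
    (trans (*-congʳ (pos-inverse 0<x)) (*-identityˡ y))

  0≤x*y⇒0≤y : ∀ {x y} → 0# < x → 0# ≤ x * y → 0# ≤ y
  0≤x*y⇒0≤y {x} {y} 0<x p = ≤-respʳ-≈ (x⁻¹*[x*y]≈y y 0<x) (*-nonNeg (<⇒≤ (⁻¹-pos 0<x)) p)

  -- The lower bounds are `- f l` and the upper bounds `g u`. First `t` is lowered until it meets
  -- all upper bounds. Then each violated lower bound raises `t` to exactly `- f l`: earlier lower
  -- bounds survive because `t` grew, and the upper bounds hold by the pairwise hypothesis for that
  -- `l`.
  between : ∀ {A B : Set} (f : A → Carrier) (g : B → Carrier) (L : List A) (U : List B) →
            All (λ l → All (λ u → 0# ≤ f l + g u) U) L →
            ∃[ t ] All (λ l → 0# ≤ t + f l) L × All (λ u → 0# ≤ g u - t) U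
  between f g [] [] [] = 0# , [] , []
  between f g [] (u ∷ U) [] with between f g [] U []
  ... | t , [] , t≤U with ≤∨> t (g u)
  ...   | inj₁ t≤u = t , [] , x≤y⇒0≤y-x t≤u ∷ t≤U
  ...   | inj₂ u<t = g u , [] , x≤y⇒0≤y-x ≤-refl ∷
            All.map (λ t≤v → x≤y⇒0≤y-x (≤-trans (<⇒≤ u<t) (0≤y-x⇒x≤y t≤v))) t≤U
  between f g (l ∷ L) U (l≤U ∷ L≤U) with between f g L U L≤U
  ... | t , L≤t , t≤U with ≤∨> 0# (t + f l)
  ...   | inj₁ l≤t = t , l≤t ∷ L≤t , t≤U
  ...   | inj₂ t<l = - f l , inj₂ (sym (-‿inverseˡ (f l))) ∷
            All.map (λ {l′} l′≤t → ≤-trans l′≤t (+-monoˡ-≤ (f l′) t≤-fl)) L≤t ,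
            All.map (λ {u} l≤u → ≤-respʳ-≈
              (trans (+-comm (f l) (g u)) (+-congˡ (sym (-‿involutive (f l))))) l≤u) l≤U
    where
    t≤-fl : t ≤ - f l
    t≤-fl = ≤-respʳ-≈ (+-identityˡ (- f l))
      (≤-respˡ-≈ (x+z-z≈x t (f l)) (+-monoˡ-≤ (- f l) (<⇒≤ t<l)))

  -- t = e / (e + K) when K > 0.
  small-multiple : ∀ {e} K → 0# < e → ∃[ t ] 0# < t × t ≤ 1# × 0# < e - t * K
  small-multiple {e} K 0<e with ≤∨> K 0#
  ... | inj₁ K≤0 = 1# , 0<1 , ≤-refl ,
        +-pos-nonNeg 0<e (x≤0⇒0≤-x (≤-respˡ-≈ (sym (*-identityˡ K)) K≤0))
  ... | inj₂ 0<K = t , *-pos 0<e 0<w , 0≤y-x⇒x≤y (≤-respʳ-≈ 1-t (*-nonNeg (<⇒≤ 0<K) (<⇒≤ 0<w))) ,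
        <-respʳ-≈ e-tK (*-pos 0<e (*-pos 0<e 0<w))
    where
    0<e+K : 0# < e + K
    0<e+K = +-pos-nonNeg 0<e (<⇒≤ 0<K)
    w t : Carrier
    w = (e + K) ⁻¹
    t = e * w
    0<w : 0# < w
    0<w = ⁻¹-pos 0<e+K
    1-t : K * w ≈ 1# - t
    1-t = trans (sym (x+z-z≈x (K * w) t)) (+-congʳ
      (trans (solve 3 (λ e K w → K :* w :+ e :* w := (e :+ K) :* w) refl e K w) (pos-inverse 0<e+K)))
    e-tK : e * (e * w) ≈ e - t * K
    e-tK = trans (sym (x+z-z≈x (e * (e * w)) (t * K))) (+-congʳ
      (trans (solve 3 (λ e K w → e :* (e :* w) :+ e :* w :* K := e :* ((e :+ K) :* w)) refl e K w)
        (trans (*-congˡ (pos-inverse 0<e+K)) (*-identityʳ e))))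

-- Polyhedral cones and their projections by Fourier-Motzkin elimination.

module PolyhedralCone (ℝ : RealNumbers) where
  open FractionalProgramming ℝ hiding (zero)
  open OrderedField ℝ

  ·-cong : ∀ {m} {a b x y : ℝ^ m} → (∀ i → a i ≈ b i) → (∀ i → x i ≈ y i) → a · x ≈ b · y
  ·-cong {ℕ.zero}  a≈b x≈y = refl
  ·-cong {ℕ.suc m} a≈b x≈y = +-cong (*-cong (a≈b zero) (x≈y zero)) (·-cong (a≈b ∘ suc) (x≈y ∘ suc))

  ·-comm : ∀ {m} (x y : ℝ^ m) → x · y ≈ y · x
  ·-comm {ℕ.zero}  x y = refl
  ·-comm {ℕ.suc m} x y = +-cong (*-comm (x zero) (y zero)) (·-comm (tail x) (tail y))

  ·-distribˡ-+ᵥ : ∀ {m} (a x y : ℝ^ m) → a · (x +ᵥ y) ≈ a · x + a · y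
  ·-distribˡ-+ᵥ {ℕ.zero}  a x y = sym (+-identityʳ 0#)
  ·-distribˡ-+ᵥ {ℕ.suc m} a x y = trans (+-congˡ (·-distribˡ-+ᵥ (tail a) (tail x) (tail y)))
    (solve 5 (λ a x y p q → a :* (x :+ y) :+ (p :+ q) := a :* x :+ p :+ (a :* y :+ q)) refl
      (a zero) (x zero) (y zero) (tail a · tail x) (tail a · tail y))

  ·-distribʳ-+ᵥ : ∀ {m} (a x y : ℝ^ m) → (x +ᵥ y) · a ≈ x · a + y · a
  ·-distribʳ-+ᵥ a x y =
    trans (·-comm (x +ᵥ y) a) (trans (·-distribˡ-+ᵥ a x y) (+-cong (·-comm a x) (·-comm a y)))

  ·-*ᵥʳ : ∀ {m} (a : ℝ^ m) t x → a · (t *ᵥ x) ≈ t * (a · x)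
  ·-*ᵥʳ {ℕ.zero}  a t x = sym (zeroʳ t)
  ·-*ᵥʳ {ℕ.suc m} a t x = trans (+-congˡ (·-*ᵥʳ (tail a) t (tail x)))
    (solve 4 (λ a t x p → a :* (t :* x) :+ t :* p := t :* (a :* x :+ p)) refl
      (a zero) t (x zero) (tail a · tail x))

  ·-*ᵥˡ : ∀ {m} t (a x : ℝ^ m) → (t *ᵥ a) · x ≈ t * (a · x)
  ·-*ᵥˡ t a x = trans (·-comm (t *ᵥ a) x) (trans (·-*ᵥʳ x t a) (*-congˡ (·-comm x a)))

  -- `_++_` computes through `splitAt`, so the two sides agree only after a case split on
  -- `splitAt m i`.
  ++-suc : ∀ {m n} (x : ℝ^ (ℕ.suc m)) (y : ℝ^ n) i → (x ++ y) (suc i) ≡ (tail x ++ y) i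
  ++-suc {m} x y i with splitAt m i
  ... | inj₁ _ = ≡.refl
  ... | inj₂ _ = ≡.refl

  ∷-++ : ∀ {m n} (x : ℝ^ (ℕ.suc m)) (y : ℝ^ n) i → (x zero ∷ᵥ (tail x ++ y)) i ≡ (x ++ y) i
  ∷-++ x y zero    = ≡.refl
  ∷-++ x y (suc i) = ≡.sym (++-suc x y i)

  ·-++ : ∀ {m n} (a x : ℝ^ m) (b y : ℝ^ n) → (a ++ b) · (x ++ y) ≈ a · x + b · y
  ·-++ {ℕ.zero}  a x b y = sym (+-identityˡ (b · y))
  ·-++ {ℕ.suc m} a x b y = trans (+-congˡ (trans
      (·-cong (λ i → reflexive (++-suc a b i)) (λ i → reflexive (++-suc x y i)))
      (·-++ (tail a) (tail x) b y)))
    (sym (+-assoc _ _ _))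

  Satisfies : ∀ {k} → List (ℝ^ k) → Pred (ℝ^ k) 0ℓ
  Satisfies T z = All (λ h → 0# ≤ h · z) T

  -- A polyhedral cone given by homogeneous inequalities; inhomogeneous systems fit in by carrying
  -- the right-hand side as the coefficient of an extra coordinate.
  IsCone : ∀ {k} → Pred (ℝ^ k) 0ℓ → Set
  IsCone Q = ∃[ T ] (∀ z → Q z ⇔ Satisfies T z)

  IsCone-⇔ : ∀ {k} {P Q : Pred (ℝ^ k) 0ℓ} → (∀ z → P z ⇔ Q z) → IsCone Q → IsCone P
  IsCone-⇔ P⇔Q (T , Q⇔T) = T , λ z → ⇔.equivalence (P⇔Q z) (Q⇔T z)

  halfspace : ∀ {k} (h : ℝ^ k) → IsCone (λ z → 0# ≤ h · z)
  halfspace h = h ∷ [] , λ z → mk⇔ (_∷ []) All.head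

  ∩-cone : ∀ {k} {P Q : Pred (ℝ^ k) 0ℓ} → IsCone P → IsCone Q → IsCone (λ z → P z × Q z)
  ∩-cone (S , P⇔S) (T , Q⇔T) = S List.++ T , λ z → mk⇔
    (λ (p , q) → All.++⁺ (to (P⇔S z) p) (to (Q⇔T z) q))
    (λ st → from (P⇔S z) (All.++⁻ˡ S st) , from (Q⇔T z) (All.++⁻ʳ S st))
    where open Equivalence

  All-cone : ∀ {k} {A : Set} {Q : A → Pred (ℝ^ k) 0ℓ} (xs : List A) →
             (∀ a → IsCone (Q a)) → IsCone (λ z → All (λ a → Q a z) xs)
  All-cone []       Q-cone = [] , λ z → mk⇔ (λ _ → []) (λ _ → [])
  All-cone (a ∷ xs) Q-cone = IsCone-⇔ (λ z → mk⇔ All.uncons (λ (p , ps) → p ∷ ps))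
    (∩-cone (Q-cone a) (All-cone xs Q-cone))

  -- An arbitrary predicate on functions need not respect pointwise `≈`. One cut out by rows does,
  -- because each product `h · z` does.
  IsCone-resp : ∀ {k} {Q : Pred (ℝ^ k) 0ℓ} → IsCone Q →
                ∀ {y z} → (∀ i → y i ≈ z i) → Q y → Q z
  IsCone-resp (T , Q⇔T) {y} {z} y≈z q = from (Q⇔T z)
    (All.map (λ {h} → ≤-respʳ-≈ (·-cong {a = h} (λ _ → refl) y≈z)) (to (Q⇔T y) q))
    where open Equivalence

  -- Rows are normalised by the absolute value of their first coefficient, and sorted by its sign.
  sort-by-head : ∀ {k} (S : List (ℝ^ (ℕ.suc k))) →
    ∃[ Z ] ∃[ L ] ∃[ U ] (∀ t z → Satisfies S (t ∷ᵥ z) ⇔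
      (Satisfies Z z × All (λ l → 0# ≤ t + l · z) L × All (λ u → 0# ≤ u · z - t) U))
  sort-by-head [] = [] , [] , [] , λ t z → mk⇔ (λ _ → [] , [] , []) (λ _ → [])
  sort-by-head {k} (h ∷ S) with sort-by-head S | compare (h zero) 0#
  ... | Z , L , U , S⇔ | tri≈ _ h₀≈0 _ = tail h ∷ Z , L , U , λ t z → mk⇔
        (λ { (p ∷ ps) → let zs , ls , us = to (S⇔ t z) ps in ≤-respʳ-≈ (eq t z) p ∷ zs , ls , us })
        (λ { (p ∷ zs , ls , us) → ≤-respʳ-≈ (sym (eq t z)) p ∷ from (S⇔ t z) (zs , ls , us) })
    where
    open Equivalence
    eq : ∀ t z → h · (t ∷ᵥ z) ≈ tail h · z
    eq t z = trans (+-congʳ (trans (*-congʳ h₀≈0) (zeroˡ t))) (+-identityˡ _)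
  ... | Z , L , U , S⇔ | tri> _ _ 0<h₀ = Z , l ∷ L , U , λ t z → mk⇔
        (λ { (p ∷ ps) → let zs , ls , us = to (S⇔ t z) ps in
          zs , 0≤x*y⇒0≤y 0<h₀ (≤-respʳ-≈ (sym (eq t z)) p) ∷ ls , us })
        (λ { (zs , p ∷ ls , us) →
          ≤-respʳ-≈ (eq t z) (*-nonNeg (<⇒≤ 0<h₀) p) ∷ from (S⇔ t z) (zs , ls , us) })
    where
    open Equivalence
    l : ℝ^ k
    l = h zero ⁻¹ *ᵥ tail h
    eq : ∀ t z → h zero * (t + l · z) ≈ h · (t ∷ᵥ z)
    eq t z = trans (distribˡ (h zero) t (l · z)) (+-congˡ
      (trans (*-congˡ (·-*ᵥˡ (h zero ⁻¹) (tail h) z)) (x*[x⁻¹*y]≈y (tail h · z) 0<h₀)))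
  ... | Z , L , U , S⇔ | tri< h₀<0 _ _ = Z , L , u ∷ U , λ t z → mk⇔
        (λ { (p ∷ ps) → let zs , ls , us = to (S⇔ t z) ps in
          zs , ls , 0≤x*y⇒0≤y 0<n (≤-respʳ-≈ (sym (eq t z)) p) ∷ us })
        (λ { (zs , ls , p ∷ us) →
          ≤-respʳ-≈ (eq t z) (*-nonNeg (<⇒≤ 0<n) p) ∷ from (S⇔ t z) (zs , ls , us) })
    where
    open Equivalence
    n : Carrier
    n = - h zero
    0<n : 0# < n
    0<n = x<0⇒0<-x h₀<0
    u : ℝ^ k
    u = n ⁻¹ *ᵥ tail h
    eq : ∀ t z → n * (u · z - t) ≈ h · (t ∷ᵥ z)
    eq t z = trans (distribˡ n (u · z) (- t)) (trans (+-comm _ _) (+-cong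
      (trans (sym (-‿distribʳ-* n t)) (trans (-‿distribˡ-* n t) (*-congʳ (-‿involutive (h zero)))))
      (trans (*-congˡ (·-*ᵥˡ (n ⁻¹) (tail h) z)) (x*[x⁻¹*y]≈y (tail h · z) 0<n))))

  -- One elimination step: rows free of `t` are kept, and each lower row is added to each upper row
  -- so that `t` cancels. Conversely, `between` recovers a common `t` from these sums.
  project-head : ∀ {k} {Q : Pred (ℝ^ (ℕ.suc k)) 0ℓ} → IsCone Q → IsCone (λ z → ∃[ t ] Q (t ∷ᵥ z))
  project-head {k} {Q} (S , Q⇔S) with sort-by-head S
  ... | Z , L , U , S⇔ = IsCone-⇔ (λ z → mk⇔ (pair z) (interpolate z))
        (∩-cone (Z , λ z → mk⇔ (λ p → p) (λ p → p))
          (All-cone L (λ l → All-cone U (λ u → halfspace (l +ᵥ u)))))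
    where
    open Equivalence
    Pairwise : Pred (ℝ^ k) 0ℓ
    Pairwise z = Satisfies Z z × All (λ l → All (λ u → 0# ≤ (l +ᵥ u) · z) U) L
    pair : ∀ z → ∃[ t ] Q (t ∷ᵥ z) → Pairwise z
    pair z (t , q) with to (S⇔ t z) (to (Q⇔S (t ∷ᵥ z)) q)
    ... | zs , ls , us = zs , All.map (λ {l} 0≤t+l → All.map (λ {u} 0≤u-t →
          ≤-respʳ-≈ (sym (trans (·-distribʳ-+ᵥ z l u) (eq t (l · z) (u · z))))
            (+-nonNeg 0≤t+l 0≤u-t)) us) ls
      where
      eq : ∀ t x y → x + y ≈ t + x + (y - t)
      eq t x y = sym (trans
        (solve 4 (λ t x y s → t :+ x :+ (y :+ s) := x :+ y :+ (t :+ s)) refl t x y (- t))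
        (trans (+-congˡ (-‿inverseʳ t)) (+-identityʳ (x + y))))
    interpolate : ∀ z → Pairwise z → ∃[ t ] Q (t ∷ᵥ z)
    interpolate z (zs , lus) with between (_· z) (_· z) L U
      (All.map (λ {l} → All.map (λ {u} → ≤-respʳ-≈ (·-distribʳ-+ᵥ z l u))) lus)
    ... | t , ls , us = t , from (Q⇔S (t ∷ᵥ z)) (from (S⇔ t z) (zs , ls , us))

  -- The coordinates of `x` are eliminated one at a time from the front. Regrouping `t ∷ᵥ (x ++ y)`
  -- as `(t ∷ᵥ x) ++ y` is only a pointwise equality, hence the use of `IsCone-resp`.
  project : ∀ m {n} {Q : Pred (ℝ^ (m ℕ.+ n)) 0ℓ} → IsCone Q →
            IsCone (λ y → ∃[ x ] Q (_++_ {m = m} x y))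
  project ℕ.zero    Q-cone = IsCone-⇔ (λ y → mk⇔ proj₂ (λ q → []ᵥ , q)) Q-cone
  project (ℕ.suc m) {n} {Q} Q-cone = IsCone-⇔ (λ y → mk⇔
      (λ (x , q) → tail x , x zero , IsCone-resp Q-cone (λ i → sym (reflexive (∷-++ x y i))) q)
      (λ (x , t , q) → t ∷ᵥ x , IsCone-resp Q-cone (λ i → reflexive (∷-++ (t ∷ᵥ x) y i)) q))
    (project m (project-head Q-cone))

-- The image cone of values and denominators, and the signs of its rows.

module Optimality (ℝ : RealNumbers) where
  open FractionalProgramming ℝ hiding (zero)
  open OrderedField ℝ
  open PolyhedralCone ℝ

  vec₃ : Carrier → Carrier → Carrier → ℝ^ 3
  vec₃ v q s = v ∷ᵥ q ∷ᵥ s ∷ᵥ []ᵥ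

  -- On a point these read off `v`, `q`, `s`; on a row they read off the coefficients α, β, γ.
  lead mid const : ℝ^ 3 → Carrier
  lead  g = g zero
  mid   g = g (suc zero)
  const g = g (suc (suc zero))

  module _ {m k} (A : Fin k → ℝ^ m) (b : ℝ^ k) (c d : ℝ^ m) where

    -- The slices s = 1 and s = 0 describe the polyhedron and its recession cone.
    Image : Pred (ℝ^ 3) 0ℓ
    Image y = ∃[ x ] ((∀ i → A i · x ≤ const y * b i) × c · x ≤ lead y × d · x ≈ mid y)

    -- Before projection the system lives in the joint variable `x ++ y`. The equation
    -- `d · x ≈ mid y` becomes the two opposite rows `rowd⁺` and `rowd⁻`, recombined by
    -- antisymmetry.
    Image-cone : IsCone Image
    Image-cone = IsCone-⇔ (λ y → mk⇔ (to′ y) (from′ y))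
      (project m (rows , λ z → mk⇔ (λ p → p) (λ p → p)))
      where
      rowA : Fin k → ℝ^ (m ℕ.+ 3)
      rowA i = (- 1# *ᵥ A i) ++ vec₃ 0# 0# (b i)
      rowc rowd⁺ rowd⁻ : ℝ^ (m ℕ.+ 3)
      rowc  = (- 1# *ᵥ c) ++ vec₃ 1# 0# 0#
      rowd⁺ = (- 1# *ᵥ d) ++ vec₃ 0# 1# 0#
      rowd⁻ = d ++ vec₃ 0# (- 1#) 0#
      rows : List (ℝ^ (m ℕ.+ 3))
      rows = rowc ∷ rowd⁺ ∷ rowd⁻ ∷ List.tabulate rowA

      neg : ∀ (a x : ℝ^ m) → (- 1# *ᵥ a) · x ≈ - (a · x)
      neg a x = trans (·-*ᵥˡ (- 1#) a x) (-1*x≈-x (a · x))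

      rowA-eq : ∀ x y i → rowA i · (x ++ y) ≈ const y * b i - A i · x
      rowA-eq x y i = trans (·-++ (- 1# *ᵥ A i) x (vec₃ 0# 0# (b i)) y) (trans (+-congʳ (neg (A i) x))
        (solve 5 (λ n v q s b → n :+ (con 0 :* v :+ (con 0 :* q :+ (b :* s :+ con 0))) := s :* b :+ n)
          refl (- (A i · x)) (lead y) (mid y) (const y) (b i)))

      rowc-eq : ∀ x y → rowc · (x ++ y) ≈ lead y - c · x
      rowc-eq x y = trans (·-++ (- 1# *ᵥ c) x (vec₃ 1# 0# 0#) y) (trans
        (+-cong (neg c x) (+-congʳ (*-identityˡ (lead y))))
        (solve 4 (λ n v q s → n :+ (v :+ (con 0 :* q :+ (con 0 :* s :+ con 0))) := v :+ n)
          refl (- (c · x)) (lead y) (mid y) (const y)))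

      rowd⁺-eq : ∀ x y → rowd⁺ · (x ++ y) ≈ mid y - d · x
      rowd⁺-eq x y = trans (·-++ (- 1# *ᵥ d) x (vec₃ 0# 1# 0#) y) (trans
        (+-cong (neg d x) (+-congˡ (+-congʳ (*-identityˡ (mid y)))))
        (solve 4 (λ n v q s → n :+ (con 0 :* v :+ (q :+ (con 0 :* s :+ con 0))) := q :+ n)
          refl (- (d · x)) (lead y) (mid y) (const y)))

      rowd⁻-eq : ∀ x y → rowd⁻ · (x ++ y) ≈ d · x - mid y
      rowd⁻-eq x y = trans (·-++ d x (vec₃ 0# (- 1#) 0#) y) (trans
        (+-congˡ (+-congˡ (+-congʳ (-1*x≈-x (mid y)))))
        (solve 4 (λ p v q s → p :+ (con 0 :* v :+ (q :+ (con 0 :* s :+ con 0))) := p :+ q)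
          refl (d · x) (lead y) (- mid y) (const y)))

      to′ : ∀ y → Image y → ∃[ x ] Satisfies rows (x ++ y)
      to′ y (x , Ax≤sb , cx≤v , dx≈q) = x ,
        ≤-respʳ-≈ (sym (rowc-eq x y)) (x≤y⇒0≤y-x cx≤v) ∷
        ≤-respʳ-≈ (sym (rowd⁺-eq x y)) (x≤y⇒0≤y-x (inj₂ dx≈q)) ∷
        ≤-respʳ-≈ (sym (rowd⁻-eq x y)) (x≤y⇒0≤y-x (inj₂ (sym dx≈q))) ∷
        All.tabulate⁺ (λ i → ≤-respʳ-≈ (sym (rowA-eq x y i)) (x≤y⇒0≤y-x (Ax≤sb i)))

      from′ : ∀ y → ∃[ x ] Satisfies rows (x ++ y) → Image y
      from′ y (x , pc ∷ pd⁺ ∷ pd⁻ ∷ pA) = x ,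
        (λ i → 0≤y-x⇒x≤y (≤-respʳ-≈ (rowA-eq x y i) (All.tabulate⁻ pA i))) ,
        0≤y-x⇒x≤y (≤-respʳ-≈ (rowc-eq x y) pc) ,
        ≤-antisym (0≤y-x⇒x≤y (≤-respʳ-≈ (rowd⁺-eq x y) pd⁺)) (0≤y-x⇒x≤y (≤-respʳ-≈ (rowd⁻-eq x y) pd⁻))

    -- The origin, written as `0# *ᵥ c`, is a preimage. This point later forces every row to have a
    -- nonnegative leading coefficient.
    Image-upward : Image (vec₃ 1# 0# 0#)
    Image-upward = 0# *ᵥ c , (λ i → inj₂ (trans (0·≈0 (A i)) (sym (zeroˡ (b i))))) ,
      ≤-respˡ-≈ (sym (0·≈0 c)) (<⇒≤ 0<1) , 0·≈0 d
      where
      0·≈0 : ∀ a → a · (0# *ᵥ c) ≈ 0#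
      0·≈0 a = trans (·-*ᵥʳ a 0# c) (zeroˡ (a · c))

  -- For a row with `0# ≤ lead g`, this says that the row fails at `(-u, 0, 1)` for every `u > 0`.
  Blocking : Pred (ℝ^ 3) 0ℓ
  Blocking g = const g < 0# ⊎ (const g ≈ 0# × 0# < lead g)

  -- A row that does not block allows all sufficiently small `u > 0`, so finitely many such rows
  -- share one `u`.
  negative-point-or-blocking : ∀ (T : List (ℝ^ 3)) → All (λ g → 0# ≤ lead g) T →
    (∃[ u ] (0# < u × All (λ g → 0# ≤ const g - u * lead g) T)) ⊎ Any Blocking T
  negative-point-or-blocking [] [] = inj₁ (1# , 0<1 , [])
  negative-point-or-blocking (g ∷ T) (0≤α ∷ 0≤αs) with negative-point-or-blocking T 0≤αs
  ... | inj₂ blocking = inj₂ (there blocking)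
  ... | inj₁ (u , 0<u , us) with compare (const g) 0#
  ...   | tri< γ<0 _ _ = inj₂ (here (inj₁ γ<0))
  ...   | tri≈ _ γ≈0 _ with ≤∨> (lead g) 0#
  ...     | inj₂ 0<α = inj₂ (here (inj₂ (γ≈0 , 0<α)))
  ...     | inj₁ α≤0 = inj₁ (u , 0<u , +-nonNeg (inj₂ (sym γ≈0))
              (≤-respʳ-≈ (sym (-‿distribʳ-* u (lead g))) (*-nonNeg (<⇒≤ 0<u) (x≤0⇒0≤-x α≤0))) ∷ us)
  negative-point-or-blocking (g ∷ T) (0≤α ∷ 0≤αs) | inj₁ (u , 0<u , us) | tri> _ _ 0<γ
    -- Scaling the old `u` by a small `t` makes the new row hold, its constant being positive. As
    -- `t ≤ 1` and leading coefficients are nonnegative, the other rows stay satisfied.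
    with small-multiple (u * lead g) 0<γ
  ... | t , 0<t , t≤1 , 0<γ-tuα = inj₁ (t * u , *-pos 0<t 0<u ,
        ≤-respʳ-≈ (+-congˡ (-‿cong (sym (*-assoc t u (lead g))))) (<⇒≤ 0<γ-tuα) ∷
        All.zipWith (λ {h} (0≤α , p) → shrink h 0≤α p) (0≤αs , us))
    where
    shrink : ∀ h → 0# ≤ lead h → 0# ≤ const h - u * lead h → 0# ≤ const h - t * u * lead h
    shrink h 0≤α p = x≤y⇒0≤y-x (≤-trans
      (≤-respˡ-≈ (sym (*-assoc t u (lead h))) (≤-respʳ-≈ (*-identityˡ (u * lead h))
        (*-monoʳ-≤ (*-nonNeg (<⇒≤ 0<u) 0≤α) t≤1)))
      (0≤y-x⇒x≤y p))

  -- At `s = 1` the last term is `const g` itself, so adding the nonnegative `- const g` removes it.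
  drop-nonpos-const : ∀ g p q → const g ≤ 0# → 0# ≤ g · vec₃ p q 1# → 0# ≤ lead g * p + mid g * q
  drop-nonpos-const g p q γ≤0 0≤gy = ≤-respʳ-≈ eq (+-nonNeg 0≤gy (x≤0⇒0≤-x γ≤0))
    where
    eq : g · vec₃ p q 1# - const g ≈ lead g * p + mid g * q
    eq = trans (+-congʳ (+-congˡ (+-congˡ (+-congʳ (*-identityʳ (const g))))))
      (trans (solve 4 (λ x y z n → x :+ (y :+ (z :+ con 0)) :+ n := x :+ y :+ (z :+ n)) refl
               (lead g * p) (mid g * q) (const g) (- const g))
        (trans (+-congˡ (-‿inverseʳ (const g))) (+-identityʳ _)))

  -- A positive combination of g and h has positive leading and nonpositive constant coefficient.
  homogeneous-bound : ∀ g h → 0# < lead g → 0# ≤ lead h → Blocking h →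
    ∃[ α ] ∃[ β ] (0# < α ×
      (∀ p q → 0# ≤ g · vec₃ p q 1# → 0# ≤ h · vec₃ p q 1# → 0# ≤ α * p + β * q))
  homogeneous-bound g h 0<α _ (inj₂ (γ≈0 , 0<α′)) =
    lead h , mid h , 0<α′ , λ p q _ → drop-nonpos-const h p q (inj₂ γ≈0)
  homogeneous-bound g h 0<α 0≤α′ (inj₁ γ′<0) with ≤∨> (const g) 0#
  ... | inj₁ γ≤0 = lead g , mid g , 0<α , λ p q pg _ → drop-nonpos-const g p q γ≤0 pg
  ... | inj₂ 0<γ = lead r , mid r , +-pos-nonNeg (*-pos 0<n 0<α) (*-nonNeg (<⇒≤ 0<γ) 0≤α′) ,
        λ p q pg ph → drop-nonpos-const r p q (inj₂ const-r)
          (≤-respʳ-≈ (sym (r-eq (vec₃ p q 1#)))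
            (+-nonNeg (*-nonNeg (<⇒≤ 0<n) pg) (*-nonNeg (<⇒≤ 0<γ) ph)))
    where
    n : Carrier
    n = - const h
    0<n : 0# < n
    0<n = x<0⇒0<-x γ′<0
    -- The multipliers `- const h` and `const g` are both positive and are chosen so that the
    -- constant coefficients cancel.
    r : ℝ^ 3
    r = n *ᵥ g +ᵥ const g *ᵥ h
    r-eq : ∀ y → r · y ≈ n * (g · y) + const g * (h · y)
    r-eq y = trans (·-distribʳ-+ᵥ y (n *ᵥ g) (const g *ᵥ h)) (+-cong (·-*ᵥˡ n g y) (·-*ᵥˡ (const g) h y))
    const-r : const r ≈ 0#
    const-r = trans (solve 3 (λ n x y → n :* x :+ x :* y := x :* (n :+ y)) refl n (const g) (const h))
      (trans (*-congˡ (-‿inverseˡ (const h))) (zeroʳ (const g)))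

  -- Divide the hypothesis by the positive number `α * q`.
  ratio-bound : ∀ {α p q} β → 0# < α → 0# < q → 0# ≤ α * p + β * q → - (β * α ⁻¹) ≤ p / q
  ratio-bound {α} {p} {q} β 0<α 0<q 0≤αp+βq = 0≤y-x⇒x≤y (≤-respʳ-≈ eq
    (*-nonNeg (<⇒≤ (*-pos (⁻¹-pos 0<α) (⁻¹-pos 0<q))) 0≤αp+βq))
    where
    eq : α ⁻¹ * q ⁻¹ * (α * p + β * q) ≈ p / q - - (β * α ⁻¹)
    eq = trans
      (solve 6 (λ α a p q w β → a :* w :* (α :* p :+ β :* q) := α :* a :* (p :* w) :+ q :* w :* (β :* a))
        refl α (α ⁻¹) p q (q ⁻¹) β)
      (+-cong (trans (*-congʳ (pos-inverse 0<α)) (*-identityˡ (p / q)))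
        (trans (*-congʳ (pos-inverse 0<q)) (trans (*-identityˡ (β * α ⁻¹)) (sym (-‿involutive _)))))

  -- Certificates of unboundedness against finite lower bounds.

  module _ {m} {𝒟 : Pred (ℝ^ m) 0ℓ} (poly : IsPolyhedron 𝒟) (c d : ℝ^ m) where
    open Equivalence

    private
      A = proj₁ (proj₂ poly)
      b = proj₁ (proj₂ (proj₂ poly))
      𝒟⇔ = proj₂ (proj₂ (proj₂ poly))

    polyhedron-convex : ∀ {s t x y} → 0# ≤ s → 0# ≤ t → s + t ≈ 1# →
                        𝒟 x → 𝒟 y → 𝒟 (s *ᵥ x +ᵥ t *ᵥ y)
    polyhedron-convex {s} {t} {x} {y} 0≤s 0≤t s+t≈1 x∈𝒟 y∈𝒟 = from (𝒟⇔ _) λ i →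
      ≤-respˡ-≈ (sym (trans (·-distribˡ-+ᵥ (A i) (s *ᵥ x) (t *ᵥ y))
                  (+-cong (·-*ᵥʳ (A i) s x) (·-*ᵥʳ (A i) t y))))
        (≤-respʳ-≈ (trans (sym (distribʳ (b i) s t)) (trans (*-congʳ s+t≈1) (*-identityˡ (b i))))
          (+-mono-≤ (*-monoˡ-≤ 0≤s (to (𝒟⇔ x) x∈𝒟 i)) (*-monoˡ-≤ 0≤t (to (𝒟⇔ y) y∈𝒟 i))))

    recession : ∀ {r} → (∀ i → A i · r ≤ 0#) → ∀ x → 𝒟 x → ∀ t → 0# ≤ t → 𝒟 (x +ᵥ t *ᵥ r)
    recession {r} Ar≤0 x x∈𝒟 t 0≤t = from (𝒟⇔ _) λ i →
      ≤-respˡ-≈ (sym (trans (·-distribˡ-+ᵥ (A i) x (t *ᵥ r)) (+-congˡ (·-*ᵥʳ (A i) t r))))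
        (≤-respʳ-≈ (trans (+-congˡ (zeroʳ t)) (+-identityʳ (b i)))
          (+-mono-≤ (to (𝒟⇔ x) x∈𝒟 i) (*-monoˡ-≤ 0≤t (Ar≤0 i))))

    Certificate : Set
    Certificate = (∃[ x ] (𝒟 x × c · x < 0# × d · x ≈ 0#)) ⊎
      (∃[ r ] (c · r < 0# × d · r ≈ 0# × (∀ x → 𝒟 x → ∀ t → 0# ≤ t → 𝒟 (x +ᵥ t *ᵥ r))))

    LowerBound : Pred Carrier 0ℓ
    LowerBound M = ∀ {x} → Feasible 𝒟 d x → M ≤ (c · x) / (d · x)

    -- A disjunction can be proved outright, since the signs of finitely many row coefficients
    -- decide which side holds.
    certificate-or-bound : Certificate ⊎ (∃[ M ] LowerBound M)
    certificate-or-bound with Image-cone A b c d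
    -- Either all rows hold at `(-1, 0, 0)`, or some row has a positive leading coefficient.
    ... | T , Image⇔T = [ inj₁ ∘ inj₂ ∘ ray , bounded ]′ (All.decide descend-or-positive T)
      where
      eval-lead : ∀ g v → g · vec₃ v 0# 0# ≈ lead g * v
      eval-lead g v = solve 4 (λ x y z v → x :* v :+ (y :* con 0 :+ (z :* con 0 :+ con 0)) := x :* v) refl
        (lead g) (mid g) (const g) v

      eval-slice : ∀ g u → g · vec₃ (- u) 0# 1# ≈ const g - u * lead g
      eval-slice g u = trans (+-congˡ (+-congˡ (+-congʳ (*-identityʳ (const g)))))
        (trans (solve 4 (λ x y z n → x :* n :+ (y :* con 0 :+ (z :+ con 0)) := z :+ n :* x) refl
                  (lead g) (mid g) (const g) (- u))
          (+-congˡ (sym (-‿distribˡ-* u (lead g)))))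

      -- The point `(1, 0, 0)` lies in the image, and a row evaluates there to its leading
      -- coefficient.
      lead-nonNeg : All (λ g → 0# ≤ lead g) T
      lead-nonNeg = All.map (λ {g} → ≤-respʳ-≈ (trans (eval-lead g 1#) (*-identityʳ (lead g))))
        (to (Image⇔T (vec₃ 1# 0# 0#)) (Image-upward A b c d))

      descend-or-positive : ∀ g → 0# ≤ g · vec₃ (- 1#) 0# 0# ⊎ 0# < lead g
      descend-or-positive g = Sum.map
        (λ α≤0 → ≤-respʳ-≈ (sym (trans (eval-lead g (- 1#))
          (trans (*-comm (lead g) (- 1#)) (-1*x≈-x (lead g))))) (x≤0⇒0≤-x α≤0))
        (λ 0<α → 0<α) (≤∨> (lead g) 0#)

      ray : Satisfies T (vec₃ (- 1#) 0# 0#) →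
            ∃[ r ] (c · r < 0# × d · r ≈ 0# × (∀ x → 𝒟 x → ∀ t → 0# ≤ t → 𝒟 (x +ᵥ t *ᵥ r)))
      ray p with from (Image⇔T (vec₃ (- 1#) 0# 0#)) p
      ... | r , Ar≤0b , cr≤-1 , dr≈0 = r , ≤-<-trans cr≤-1 (0<x⇒-x<0 0<1) , dr≈0 ,
            recession (λ i → ≤-respʳ-≈ (zeroˡ (b i)) (Ar≤0b i))

      image-of : ∀ {x} → 𝒟 x → Satisfies T (vec₃ (c · x) (d · x) 1#)
      image-of {x} x∈𝒟 = to (Image⇔T (vec₃ (c · x) (d · x) 1#))
        (x , (λ i → ≤-respʳ-≈ (sym (*-identityˡ (b i))) (to (𝒟⇔ x) x∈𝒟 i)) , ≤-refl , refl)

      bounded : Any (λ g → 0# < lead g) T → Certificate ⊎ (∃[ M ] LowerBound M)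
      bounded positive with negative-point-or-blocking T lead-nonNeg
      ... | inj₁ (u , 0<u , us)
            with from (Image⇔T (vec₃ (- u) 0# 1#))
                   (All.map (λ {g} → ≤-respʳ-≈ (sym (eval-slice g u))) us)
      ...   | x , Ax≤1b , cx≤-u , dx≈0 = inj₁ (inj₁ (x ,
              from (𝒟⇔ x) (λ i → ≤-respʳ-≈ (*-identityˡ (b i)) (Ax≤1b i)) ,
              ≤-<-trans cx≤-u (0<x⇒-x<0 0<u) , dx≈0))
      bounded positive | inj₂ blocking
        with find positive | find blocking
      ... | g , g∈T , 0<α | h , h∈T , h-blocking
        with homogeneous-bound g h 0<α (All.lookup lead-nonNeg h∈T) h-blocking
      -- Both `g` and `h` hold at `(c · x, d · x, 1)` for each `x` in `𝒟`, so their combination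
      -- bounds the ratio uniformly.
      ... | α , β , 0<α′ , bound = inj₂ (- (β * α ⁻¹) , λ {x} (0<dx , x∈𝒟) →
            ratio-bound β 0<α′ 0<dx (bound (c · x) (d · x)
              (All.lookup (image-of x∈𝒟) g∈T) (All.lookup (image-of x∈𝒟) h∈T)))

    certificate⇒unbounded : ∀ {x₀} → 𝒟 x₀ → 0# < d · x₀ → Certificate → ∀ M → ¬ LowerBound M
    certificate⇒unbounded {x₀} x₀∈𝒟 0<dx₀ cert M M-bound = [ slice , direction ]′ cert
      where
      f : ℝ^ m
      f = c +ᵥ (- M) *ᵥ d

      f-eq : ∀ x → f · x ≈ c · x + - M * (d · x)
      f-eq x = trans (·-distribʳ-+ᵥ x c ((- M) *ᵥ d)) (+-congˡ (·-*ᵥˡ (- M) d x))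

      -- Multiplying the bound by the positive denominator turns it into a linear inequality.
      f-nonNeg : ∀ {x} → Feasible 𝒟 d x → 0# ≤ f · x
      f-nonNeg {x} x-feas@(0<dx , _) = ≤-respʳ-≈ eq
        (*-nonNeg (<⇒≤ 0<dx) (x≤y⇒0≤y-x (M-bound x-feas)))
        where
        eq : (d · x) * ((c · x) / (d · x) - M) ≈ f · x
        eq = trans (solve 4 (λ q p w n → q :* (p :* w :+ n) := q :* w :* p :+ n :* q) refl
                     (d · x) (c · x) ((d · x) ⁻¹) (- M))
          (trans (+-congʳ (trans (*-congʳ (pos-inverse 0<dx)) (*-identityˡ (c · x)))) (sym (f-eq x)))

      -- Where `d` vanishes, `f` agrees with `c`, whatever `M` is.
      f-neg : ∀ {x} → c · x < 0# → d · x ≈ 0# → 0# < - (f · x)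
      f-neg {x} cx<0 dx≈0 = x<0⇒0<-x (<-respˡ-≈ (sym (trans (f-eq x)
        (trans (+-congˡ (trans (*-congˡ dx≈0) (zeroʳ (- M)))) (+-identityʳ (c · x))))) cx<0)

      absurd : ∀ {x y} → 0# < x → 0# ≤ y → x + y ≈ 0# → ⊥
      absurd 0<x 0≤y x+y≈0 = irrefl (sym x+y≈0) (+-pos-nonNeg 0<x 0≤y)

      slice : ¬ (∃[ x ] (𝒟 x × c · x < 0# × d · x ≈ 0#))
      -- The positive quantity obtained is `- (f · y)` for the point `y` at fraction `t` of the way
      -- from `x` to `x₀`; `0# < t` makes `d · y` positive, so `y` is feasible.
      slice (x , x∈𝒟 , cx<0 , dx≈0) with small-multiple (f · x₀ - f · x) (f-neg cx<0 dx≈0)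
      ... | t , 0<t , t≤1 , 0<e-tK = absurd 0<e-tK (f-nonNeg (0<dy , y∈𝒟)) eq
        where
        y : ℝ^ m
        y = (1# - t) *ᵥ x +ᵥ t *ᵥ x₀
        y-eq : ∀ a → a · y ≈ (1# - t) * (a · x) + t * (a · x₀)
        y-eq a = trans (·-distribˡ-+ᵥ a ((1# - t) *ᵥ x) (t *ᵥ x₀))
          (+-cong (·-*ᵥʳ a (1# - t) x) (·-*ᵥʳ a t x₀))
        y∈𝒟 : 𝒟 y
        y∈𝒟 = polyhedron-convex (x≤y⇒0≤y-x t≤1) (<⇒≤ 0<t) (x-z+z≈x 1# t) x∈𝒟 x₀∈𝒟
        0<dy : 0# < d · y
        0<dy = <-respʳ-≈ (sym (trans (y-eq d) (trans
          (+-congʳ (trans (*-congˡ dx≈0) (zeroʳ (1# - t)))) (+-identityˡ _)))) (*-pos 0<t 0<dx₀)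
        eq : - (f · x) - t * (f · x₀ - f · x) + f · y ≈ 0#
        eq = trans (+-cong
            (+-cong (sym (*-identityˡ _)) (-‿distribˡ-* t _)) (y-eq f))
          -- With `n` for `- t` and `e` for `- (f · x)`, the sum regroups into two products, with
          -- the vanishing factors `e + F` and `n + t`.
          (trans (solve 6 (λ o t n F e G → o :* e :+ n :* (G :+ e) :+ ((o :+ n) :* F :+ t :* G)
                              := (o :+ n) :* (e :+ F) :+ (n :+ t) :* G) refl
                    1# t (- t) (f · x) (- (f · x)) (f · x₀))
            (trans (+-cong (trans (*-congˡ (-‿inverseˡ (f · x))) (zeroʳ _))
                      (trans (*-congʳ (-‿inverseˡ t)) (zeroˡ _)))
              (+-identityʳ 0#)))

      direction : ¬ (∃[ r ] (c · r < 0# × d · r ≈ 0# ×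
                     (∀ x → 𝒟 x → ∀ t → 0# ≤ t → 𝒟 (x +ᵥ t *ᵥ r))))
      -- A small `s` means a long step `s ⁻¹` along `r`. The denominator stays `d · x₀`, while
      -- `s * (f · y)` equals `s * (f · x₀) + f · r`, which is negative.
      direction (r , cr<0 , dr≈0 , r-rec) with small-multiple (f · x₀) (f-neg cr<0 dr≈0)
      ... | s , 0<s , _ , 0<e-sK = absurd 0<e-sK (*-nonNeg (<⇒≤ 0<s) (f-nonNeg (0<dy , y∈𝒟))) eq
        where
        y : ℝ^ m
        y = x₀ +ᵥ s ⁻¹ *ᵥ r
        y-eq : ∀ a → a · y ≈ a · x₀ + s ⁻¹ * (a · r)
        y-eq a = trans (·-distribˡ-+ᵥ a x₀ (s ⁻¹ *ᵥ r)) (+-congˡ (·-*ᵥʳ a (s ⁻¹) r))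
        y∈𝒟 : 𝒟 y
        y∈𝒟 = r-rec x₀ x₀∈𝒟 (s ⁻¹) (<⇒≤ (⁻¹-pos 0<s))
        0<dy : 0# < d · y
        0<dy = <-respʳ-≈ (sym (trans (y-eq d) (trans
          (+-congˡ (trans (*-congˡ dr≈0) (zeroʳ (s ⁻¹)))) (+-identityʳ _)))) 0<dx₀
        eq : - (f · r) - s * (f · x₀) + s * (f · y) ≈ 0#
        eq = trans (+-congˡ (trans (*-congˡ (y-eq f)) (trans (distribˡ s _ _)
            (+-congˡ (x*[x⁻¹*y]≈y (f · r) 0<s)))))
          (trans (solve 4 (λ e n p F → e :+ n :+ (p :+ F) := e :+ F :+ (n :+ p)) refl
                    (- (f · r)) (- (s * (f · x₀))) (s * (f · x₀)) (f · r))
            (trans (+-cong (-‿inverseˡ (f · r)) (-‿inverseˡ (s * (f · x₀)))) (+-identityʳ 0#)))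

-- The optimal value in the extended reals.

theorem3p7 : (ℝ : RealNumbers) → let open FractionalProgramming ℝ in
    (m : ℕ) (𝒟 : Pred (ℝ^ m) 0ℓ) → IsPolyhedron 𝒟 →
    (c d : ℝ^ m) →
    (∃[ x ] (𝒟 x × 0# < d · x)) →
    IsOptimalValue 𝒟 c d ⊥± ⇔
    ((∃[ x ] (𝒟 x × c · x < 0# × d · x ≈ 0#))
    ⊎
    (∃[ r ] (c · r < 0# × d · r ≈ 0# ×
    (∀ x → 𝒟 x → ∀ t → 0# ≤ t → 𝒟 (x +ᵥ t *ᵥ r)))))
theorem3p7 ℝ m 𝒟 poly c d (x₀ , x₀∈𝒟 , 0<dx₀) = mk⇔ certify unbounded
  where
  open FractionalProgramming ℝ
  open Optimality ℝ
  module ± = Extrema _≤_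

  ¬[]≤⊥ : ∀ {M} → ¬ ([ M ] ≤± ⊥±)
  -- The extended order adds a top to the order that already has a bottom, so the outer layer is
  -- removed before the empty case appears.
  ¬[]≤⊥ Supremum.[ () ]

  certify : IsOptimalValue 𝒟 c d ⊥± → Certificate poly c d
  -- A finite lower bound `M` would have to lie below the infimum `⊥±`.
  certify (_ , greatest) = [ (λ cert → cert) , (λ (M , M-bound) →
    ⊥-elim (¬[]≤⊥ (greatest (λ x-feas → ±.[ M-bound x-feas ])))) ]′ (certificate-or-bound poly c d)

  unbounded : Certificate poly c d → IsOptimalValue 𝒟 c d ⊥±
  unbounded cert = (λ _ → ±.⊥±≤ _) , λ {w} → below w
    where
    below : ∀ w → (∀ {x} → Feasible 𝒟 d x → w ≤± [ (c · x) / (d · x) ]) → w ≤± ⊥±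
    below ⊥±    _     = ±.⊥±≤ ⊥±
    below [ M ] bound = ⊥-elim (certificate⇒unbounded poly c d x₀∈𝒟 0<dx₀ cert M
      (λ x-feas → ±.[≤]-injective (bound x-feas)))
    -- The feasible point `x₀` has a finite ratio, so `⊤±` is not a lower bound.
    below ⊤±    bound with () ← bound {x₀} (0<dx₀ , x₀∈𝒟)
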